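{- Let $G$ be a planar $st$-digraph. Then $G$ has a hamiltonian path if and only if $G$ contains neither a strong rhombus nor a weak rhombus.
   Context: An $st$-digraph is a finite acyclic digraph with exactly one source $s$ (in-degree $0$) and exactly one sink $t$ (out-degree $0$). A planar $st$-digraph is an $st$-digraph together with a fixed planar embedding in which $s$ and $t$ lie on the external face; it is drawn upward (every edge is a curve strictly increasing in the vertical direction). A hamiltonian path is a directed path visiting every vertex exactly once. Every internal face $f$ of a planar $st$-digraph is bounded by two directed paths (its left side and its right side) from a common face source to a common face sink. A face is a generalized triangle if one of its sides is a single edge and the other side contains at least one vertex besides the face source and face sink; it is left-sided (resp. right-sided) if its left (resp. right) side is the longer one. $G$ contains a weak rhombus if some internal face of $G$ has at least one vertex other than its face source and face sink on each of its two sides. $G$ contains a strong rhombus if there is an edge $(s',t')$ of $G$ such that the face to its left is a left-sided generalized triangle whose right side is exactly the edge $(s',t')$ and the face to its right is a right-sided generalized triangle whose left side is exactly the edge $(s',t')$ (so both faces have face source $s'$ and face sink $t'$). -}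

module Defs where

open import Data.Nat using (ℕ; zero; suc; _+_; _*_; _≤_; _≤ᵇ_)
open import Data.Fin using (Fin; toℕ)
open import Data.Fin.Properties using () renaming (_≟_ to _≟ᶠ_)
open import Data.Bool using (Bool; true; false; not; _∧_; _∨_; if_then_else_)
open import Data.Bool.Properties using () renaming (_≟_ to _≟ᵇ_)
open import Data.Product using (Σ; ∃; ∃-syntax; _×_; _,_; proj₁; proj₂)
open import Data.Product.Properties using (≡-dec)
open import Data.List using (List; []; _∷_; length; concatMap; allFin; upTo)
open import Data.Bool.ListAction using (any; all)
open import Function using (_∘_)
open import Function.Definitions using (Injective)
open import Relation.Binary.PropositionalEquality using (_≡_)
open import Relation.Nullary using (¬_; ⌊_⌋; does)
open import Data.Empty using (⊥)

record Digraph : Set where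
  field
    n    : ℕ
    m    : ℕ
    tail : Fin m → Fin n
    head : Fin m → Fin n
    simple : ∀ e e' → tail e ≡ tail e' → head e ≡ head e' → e ≡ e'

module _ (G : Digraph) where
  open Digraph G

  data Reach⁺ : Fin n → Fin n → Set where
    one  : (e : Fin m) → Reach⁺ (tail e) (head e)
    more : {v : Fin n} (e : Fin m) → Reach⁺ (head e) v → Reach⁺ (tail e) v

  Acyclic : Set
  Acyclic = ∀ v → ¬ Reach⁺ v v

  IsSource : Fin n → Set
  IsSource v = ¬ (∃[ e ] head e ≡ v)

  IsSink : Fin n → Set
  IsSink v = ¬ (∃[ e ] tail e ≡ v)

  -- hamiltonian path: an ordering p 0, p 1, ..., p (n-1) of the vertices
  -- visiting every vertex exactly once (p injective on Fin n, hence a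
  -- bijection), consecutive vertices joined by an edge p i → p (i+1).
  HamiltonianPath : Set
  HamiltonianPath =
    Σ (Fin n → Fin n) λ p →
      Injective _≡_ _≡_ p ×
      (∀ i j → toℕ j ≡ suc (toℕ i) → ∃[ e ] (tail e ≡ p i × head e ≡ p j))

  -- Darts (half-edges): (e , true) is e seen from its tail (pointing
  -- upward/outgoing), (e , false) is e seen from its head.

  Dart : Set
  Dart = Fin m × Bool

  vert : Dart → Fin n
  vert (e , true)  = tail e
  vert (e , false) = head e

  rev : Dart → Dart
  rev (e , b) = (e , not b)

  allDarts : List Dart
  allDarts = concatMap (λ e → (e , true) ∷ (e , false) ∷ []) (allFin m)

  _≟d_ : (d d' : Dart) → Relation.Nullary.Dec (d ≡ d')
  _≟d_ = ≡-dec _≟ᶠ_ _≟ᵇ_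

  countDarts : (Dart → Bool) → ℕ
  countDarts P = go allDarts
    where
      go : List Dart → ℕ
      go [] = 0
      go (d ∷ ds) = if P d then suc (go ds) else go ds

  code : Dart → ℕ
  code (e , b) = 2 * toℕ e + (if b then 1 else 0)

iter : {A : Set} → (A → A) → ℕ → A → A
iter f zero    x = x
iter f (suc k) x = f (iter f k x)

module _ (G : Digraph) where
  open Digraph G

  -- Combinatorial embedding (rotation system): σ d is the dart following
  -- d in COUNTERCLOCKWISE order around the vertex vert d.  σ is a
  -- permutation whose cycles are exactly the sets of darts at each vertex.

  record Rotation : Set where
    field
      σ    : Dart G → Dart G
      σ⁻¹  : Dart G → Dart G
      σ⁻¹σ : ∀ d → σ⁻¹ (σ d) ≡ d
      σσ⁻¹ : ∀ d → σ (σ⁻¹ d) ≡ d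
      σ-vert  : ∀ d → vert G (σ d) ≡ vert G d
      σ-cycle : ∀ d d' → vert G d ≡ vert G d' → ∃[ k ] iter σ k d ≡ d'

    -- face permutation: after traversing dart d, turn to the next dart
    -- counterclockwise at the other endpoint.  Faces are the orbits of φ;
    -- the face of a dart lies to the RIGHT of the dart's direction.
    φ : Dart G → Dart G
    φ = σ ∘ rev G

    -- d' lies in the φ-orbit (face) of d  (orbits have size ≤ 2m)
    sameFace : Dart G → Dart G → Bool
    sameFace d d' = any (λ k → does (_≟d_ G (iter φ k d) d')) (upTo (2 * m))

    isRep : Dart G → Bool
    isRep d = all (λ d' → not (sameFace d d') ∨ (code G d ≤ᵇ code G d')) (allDarts G)

    faceCount : ℕ
    faceCount = countDarts G isRep

    -- Face of dart d.  Darts traversed forward (along edge direction)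
    -- form the LEFT side of an internal face, darts traversed backward its
    -- RIGHT side (faces are traversed clockwise in the upward drawing).
    leftLen : Dart G → ℕ
    leftLen d = countDarts G (λ d' → sameFace d d' ∧ proj₂ d')

    rightLen : Dart G → ℕ
    rightLen d = countDarts G (λ d' → sameFace d d' ∧ not (proj₂ d'))

record PlanarSTDigraph : Set where
  field
    graph : Digraph
  open Digraph graph public
  field
    acyclic : Acyclic graph
    s : Fin n
    t : Fin n
    s-source : IsSource graph s
    s-unique : ∀ v → IsSource graph v → v ≡ s
    t-sink   : IsSink graph t
    t-unique : ∀ v → IsSink graph v → v ≡ t
    rot : Rotation graph
  open Rotation rot public
  field
    -- genus 0 (Euler's formula; G is connected since every vertex is
    -- reachable from s)
    euler : n + faceCount ≡ m + 2
    -- the external face, given by one of its darts, contains s and t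
    outer   : Dart graph
    s-outer : ∃[ d ] (sameFace outer d ≡ true × vert graph d ≡ s)
    t-outer : ∃[ d ] (sameFace outer d ≡ true × vert graph d ≡ t)

  Internal : Dart graph → Set
  Internal d = sameFace outer d ≡ false

module _ (P : PlanarSTDigraph) where
  open PlanarSTDigraph P

  -- an internal face with ≥ 1 vertex besides face source/sink on each
  -- side, i.e. each side has ≥ 2 edges
  WeakRhombus : Set
  WeakRhombus = ∃[ d ] (Internal d × 2 ≤ leftLen d × 2 ≤ rightLen d)

  -- face left of edge e = face of dart (e , false) (e traversed downward);
  -- face right of e = face of dart (e , true).
  -- Left face: left-sided generalized triangle with right side exactly e.
  -- Right face: right-sided generalized triangle with left side exactly e.
  StrongRhombus : Set
  StrongRhombus = ∃[ e ]
    ( (Internal (e , false) × rightLen (e , false) ≡ 1 × 2 ≤ leftLen (e , false))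
    × (Internal (e , true) × leftLen (e , true) ≡ 1 × 2 ≤ rightLen (e , true)))

{-# OPTIONS --safe #-}
module Submission where

-- Around a vertex v, call the gap between a dart d and its successor σ d an angle
-- if d and σ d have the same direction. Each face has at least one angle of
-- outgoing darts and one of incoming darts, its source and its sink, and each
-- v ≠ s , t has a gap where out-darts turn into in-darts. Euler's formula makes
-- these counts exact: every face has one source angle and one sink angle, and the
-- internal faces with source v are one fewer than the edges leaving v.
--
-- Without rhombi every internal face has exactly one chord (an edge that is a
-- whole side of it), and different faces have different chords. So exactly one
-- edge leaving each v ≠ t, and exactly one entering each v ≠ s, is not a chord;
-- these edges form the hamiltonian path.
--
-- Conversely, let vertices be ranked by a hamiltonian path. For a threshold c the
-- internal faces with sink of rank < c are at most as many as the edges with head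
-- of rank < c, less one for each possible predecessor on the path, because at each
-- such v these edges cannot be linked all around v. Counting at the sinks gives
-- equality, whereas a rhombus makes the inequality strict for a suitable c.

open import Defs
open import Data.Bool using (Bool; true; false; not; _∧_; if_then_else_; T)
open import Data.Bool.Properties using (T-≡; T-∧; not-involutive; not-injective; not-¬; ¬-not) renaming (_≟_ to _≟ᵇ_)
open import Data.Empty using (⊥; ⊥-elim)
open import Data.Fin using (Fin; zero; suc; toℕ; fromℕ<; combine; punchOut; splitAt; join)
open import Data.Fin.Properties using (toℕ<n; toℕ-combine; toℕ-fromℕ<; toℕ-injective; any?; pigeonhole; injective⇒≤; combine-injective; punchOut-injective; splitAt-join; join-splitAt) renaming (_≟_ to _≟ᶠ_)
open import Data.List using (List; []; _∷_; length; filterᵇ; lookup; concatMap; allFin; upTo)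
open import Data.List.Membership.Propositional using (_∈_; lose)
open import Data.List.Membership.Propositional.Properties using (∈-allFin; ∈-upTo⁺; ∈-filter⁺; ∈-filter⁻; ∈-lookup)
open import Data.List.Relation.Unary.All using (All; []; _∷_) renaming (lookup to All-lookup)
open import Data.List.Relation.Unary.All.Properties using () renaming (all⁺ to All-all⁺)
open import Data.List.Relation.Unary.AllPairs using ([]; _∷_)
open import Data.List.Relation.Unary.Any using (here; there; satisfied)
open import Data.List.Relation.Unary.Any.Properties using (any⁺; any⁻)
open import Data.List.Relation.Unary.Unique.Propositional using (Unique)
open import Data.List.Relation.Unary.Unique.Propositional.Properties using (allFin⁺; filter⁺)
open import Data.Nat using (ℕ; zero; suc; _+_; _*_; _∸_; _≤_; _<_; z≤n; s≤s; _<?_)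
open import Data.Nat.Properties
open import Data.Product using (∃-syntax; _×_; _,_; proj₁; proj₂)
open import Data.Sum using (_⊎_; inj₁; inj₂)
open import Function using (_∘_; id)
open import Function.Bundles using (_⇔_; mk⇔; Equivalence)
open import Function.Definitions using (Injective)
open import Relation.Binary.PropositionalEquality
open import Relation.Nullary using (¬_; Dec; yes; no; does; contradiction; T?)
open import Relation.Nullary.Decidable using (_×-dec_; _⊎-dec_; ¬?; dec-true)

-- Orbits of injective maps on finite sets.

module _ {A : Set} (f : A → A) where

  iter-+ : ∀ a b x → iter f (a + b) x ≡ iter f a (iter f b x)
  iter-+ zero    b x = refl
  iter-+ (suc a) b x = cong f (iter-+ a b x)

  iter-comm : ∀ k x → iter f k (f x) ≡ f (iter f k x)
  iter-comm zero    x = refl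
  iter-comm (suc k) x = cong f (iter-comm k x)

  iter-injective : Injective _≡_ _≡_ f → ∀ k → Injective _≡_ _≡_ (iter f k)
  iter-injective inj zero    eq = eq
  iter-injective inj (suc k) eq = iter-injective inj k (inj eq)

  iter-fixed : ∀ {x} → f x ≡ x → ∀ k → iter f k x ≡ x
  iter-fixed fix zero    = refl
  iter-fixed fix (suc k) = trans (cong f (iter-fixed fix k)) fix

  iter-reduce : ∀ p x → 1 ≤ p → iter f p x ≡ x →
                ∀ k → ∃[ r ] (r < p × iter f r x ≡ iter f k x)
  iter-reduce p x 1≤p per zero = 0 , 1≤p , refl
  iter-reduce p x 1≤p per (suc k) with iter-reduce p x 1≤p per k
  ... | r , r<p , eq with suc r <? p
  ...   | yes q = suc r , q , cong f eq
  ...   | no ¬q = 0 , 1≤p , trans (sym per)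
                  (trans (cong (λ j → iter f j x) (≤-antisym (≮⇒≥ ¬q) r<p)) (cong f eq))

  -- A search along an orbit that carries an invariant `Q` until `B` occurs. On a cyclic orbit, the
  -- case where `B` never occurs brings `Q` all the way round.
  iter-until : (Q B : A → Set) → (∀ x → Q x → B x ⊎ Q (f x)) → ∀ x → Q x → ∀ k →
               (∃[ j ] (Q (iter f j x) × B (iter f j x))) ⊎ Q (iter f k x)
  iter-until Q B step x q zero = inj₂ q
  iter-until Q B step x q (suc k) with iter-until Q B step x q k
  ... | inj₁ found = inj₁ found
  ... | inj₂ q′ with step _ q′
  ...   | inj₁ b = inj₁ (k , q′ , b)
  ...   | inj₂ q″ = inj₂ q″

  -- Two of the first `N + 1` iterates coincide; injectivity cancels the common initial part.
  iter-period : Injective _≡_ _≡_ f → ∀ {N} (c : A → Fin N) → Injective _≡_ _≡_ c →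
                ∀ x → ∃[ p ] (1 ≤ p × p ≤ N × iter f p x ≡ x)
  iter-period inj {N} c c-inj x with pigeonhole (n<1+n N) (λ i → c (iter f (toℕ i) x))
  ... | i , j , i<j , eq =
    toℕ j ∸ toℕ i , m<n⇒0<n∸m i<j , ≤-trans (m∸n≤m (toℕ j) (toℕ i)) (≤-pred (toℕ<n j)) ,
    sym (iter-injective inj (toℕ i) (trans (c-inj eq)
      (trans (cong (λ k → iter f k x) (sym (m+[n∸m]≡n (<⇒≤ i<j)))) (iter-+ (toℕ i) _ x))))

-- Each counting equality is exploited in this form. If `y` were missed, deleting it would embed
-- `suc a` points into `a`.
injective⇒surjective : ∀ {a b} → a ≡ b → (f : Fin a → Fin b) → Injective _≡_ _≡_ f →
                       ∀ y → ∃[ x ] f x ≡ y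
injective⇒surjective {suc a} refl f inj y with any? (λ x → f x ≟ᶠ y)
... | yes found = found
... | no  none  = ⊥-elim (1+n≰n (injective⇒≤ {f = g} g-inj))
  where
  missed : ∀ x → ¬ y ≡ f x
  missed x eq = none (x , sym eq)
  g : Fin (suc a) → Fin a
  g x = punchOut (missed x)
  g-inj : Injective _≡_ _≡_ g
  g-inj {x} {x′} eq = inj (punchOut-injective (missed x) (missed x′) eq)

surjective⇒≤ : ∀ {a b} (f : Fin a → Fin b) → (∀ y → ∃[ x ] f x ≡ y) → b ≤ a
surjective⇒≤ f surj = injective⇒≤ {f = proj₁ ∘ surj}
  (λ {y} {y′} eq → trans (sym (proj₂ (surj y))) (trans (cong f eq) (proj₂ (surj y′))))

-- An injective self-map all of whose orbits meet z is a single cycle.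
cycle-injective : ∀ {n} (f : Fin n → Fin n) → Injective _≡_ _≡_ f → (z : Fin n) →
                  (∀ v → ∃[ k ] iter f k v ≡ z) →
                  ∀ {i j} → i < j → j < n → ¬ iter f i z ≡ iter f j z
cycle-injective {n} f inj z hits {i} {j} i<j j<n eq = shorter (j ∸ i) (m<n⇒0<n∸m i<j)
  (≤-<-trans (m∸n≤m j i) j<n)
  (sym (iter-injective f inj i
    (trans eq (trans (cong (λ k → iter f k z) (sym (m+[n∸m]≡n (<⇒≤ i<j)))) (iter-+ f i _ z)))))
  where
  shorter : ∀ d → 1 ≤ d → d < n → iter f d z ≡ z → ⊥
  shorter (suc d) _ d<n per = <⇒≱ d<n (surjective⇒≤ (λ r → iter f (toℕ r) z) covers)
    where
    -- Going backward from `z`, injectivity identifies each preimage with the previous iterate; the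
    -- preimage of `z` itself is iterate `d`, by `per`. So `suc d` iterates would cover all `n`
    -- points.
    trace : ∀ k v → iter f k v ≡ z → ∃[ r ] (r < suc d × iter f r z ≡ v)
    trace zero    v eq = 0 , s≤s z≤n , sym eq
    trace (suc k) v eq with trace k (f v) (trans (iter-comm f k v) eq)
    ... | zero  , _   , z≡fv = d , ≤-refl , inj (trans per z≡fv)
    ... | suc r , r<d , eq′  = r , <-trans (n<1+n r) r<d , inj eq′
    covers : ∀ v → ∃[ r ] iter f (toℕ r) z ≡ v
    covers v with hits v
    ... | k , hit with trace k v hit
    ...   | r , r<d , eq = fromℕ< r<d , trans (cong (λ k → iter f k z) (toℕ-fromℕ< r<d)) eq

-- Dart counts as lengths of duplicate-free lists.

lookup-injective : ∀ {A : Set} {xs : List A} → Unique xs → Injective _≡_ _≡_ (lookup xs)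
lookup-injective (x∉ ∷ u) {zero}  {zero}  eq = refl
lookup-injective (x∉ ∷ u) {zero}  {suc j} eq = contradiction eq (All-lookup x∉ (∈-lookup j))
lookup-injective (x∉ ∷ u) {suc i} {zero}  eq = contradiction (sym eq) (All-lookup x∉ (∈-lookup i))
lookup-injective (x∉ ∷ u) {suc i} {suc j} eq = cong suc (lookup-injective u eq)

T-does : {A : Set} (a? : Dec A) → T (does a?) → A
T-does (yes a) _ = a

-- countDarts recurses through a local function that cannot be named here; go
-- is to be unified with it.
foldCount : {A : Set} (P : A → Bool) (go : List A → ℕ) → go [] ≡ 0 →
  (∀ d ds → go (d ∷ ds) ≡ (if P d then suc (go ds) else go ds)) →
  ∀ xs → go xs ≡ length (filterᵇ P xs)
foldCount P go z c [] = z
foldCount P go z c (x ∷ xs) with P x | c x xs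
... | true  | h = trans h (cong suc (foldCount P go z c xs))
... | false | h = trans h (foldCount P go z c xs)

module Count (G : Digraph) where
  open Digraph G

  ∈-allDarts : ∀ d → d ∈ allDarts G
  ∈-allDarts (e , b) = go (allFin m) (∈-allFin e) b
    where
    go : ∀ es → e ∈ es → ∀ b → (e , b) ∈ concatMap (λ e → (e , true) ∷ (e , false) ∷ []) es
    go _ (here refl) true  = here refl
    go _ (here refl) false = there (here refl)
    go _ (there e∈)  b     = there (there (go _ e∈ b))

  allDarts-unique : Unique (allDarts G)
  allDarts-unique = go (allFin⁺ m)
    where
    fresh : ∀ {e es} b → All (λ e′ → ¬ e ≡ e′) es →
            All (λ d → ¬ (e , b) ≡ d) (concatMap (λ e → (e , true) ∷ (e , false) ∷ []) es)
    fresh b []         = []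
    fresh b (e≢ ∷ all) = (e≢ ∘ cong proj₁) ∷ (e≢ ∘ cong proj₁) ∷ fresh b all
    go : ∀ {es} → Unique es → Unique (concatMap (λ e → (e , true) ∷ (e , false) ∷ []) es)
    go []       = []
    go (e∉ ∷ u) = ((λ ()) ∷ fresh true e∉) ∷ fresh false e∉ ∷ go u

  module _ (P : Dart G → Bool) where

    selected : List (Dart G)
    selected = filterᵇ P (allDarts G)

    countDarts-length : countDarts G P ≡ length selected
    countDarts-length with allDarts G | foldCount P _ refl (λ _ _ → refl)
    ... | xs | fold = fold xs

    selected-unique : Unique selected
    selected-unique = filter⁺ (λ d → T? (P d)) allDarts-unique

    ∈-selected : ∀ {d} → P d ≡ true → d ∈ selected
    ∈-selected {d} Pd = ∈-filter⁺ (λ d → T? (P d)) (∈-allDarts d) (Equivalence.from T-≡ Pd)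

    selected-sound : ∀ {d} → d ∈ selected → P d ≡ true
    selected-sound d∈ = Equivalence.to T-≡ (proj₂ (∈-filter⁻ (λ d → T? (P d)) {xs = allDarts G} d∈))

    enum : Fin (countDarts G P) → Dart G
    enum i = lookup selected (subst Fin countDarts-length i)

    enum-injective : Injective _≡_ _≡_ enum
    enum-injective eq = subst-injective {P = Fin} countDarts-length (lookup-injective selected-unique eq)

    enum-sound : ∀ i → P (enum i) ≡ true
    enum-sound i = selected-sound (∈-lookup (subst Fin countDarts-length i))

    count≥2 : ∀ {d d′} → P d ≡ true → P d′ ≡ true → ¬ d ≡ d′ → 2 ≤ countDarts G P
    count≥2 Pd Pd′ d≢ = subst (2 ≤_) (sym countDarts-length) (go (∈-selected Pd) (∈-selected Pd′) d≢)
      where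
      go : ∀ {d d′ : Dart G} {xs} → d ∈ xs → d′ ∈ xs → ¬ d ≡ d′ → 2 ≤ length xs
      go (here refl) (here refl) d≢ = contradiction refl d≢
      go {xs = _ ∷ _ ∷ _} (here _) (there _) d≢ = s≤s (s≤s z≤n)
      go {xs = _ ∷ _ ∷ _} (there _) _ d≢ = s≤s (s≤s z≤n)

    count≡1 : ∀ {d} → P d ≡ true → (∀ d′ → P d′ ≡ true → d′ ≡ d) → countDarts G P ≡ 1
    count≡1 {d} Pd only = trans countDarts-length
      (go (∈-selected Pd) selected-unique (λ x∈ → only _ (selected-sound x∈)))
      where
      go : ∀ {xs} → d ∈ xs → Unique xs → (∀ {x} → x ∈ xs → x ≡ d) → length xs ≡ 1
      go {_ ∷ []}    _ _               _  = refl
      go {_ ∷ _ ∷ _} _ ((x≢y ∷ _) ∷ _) eq =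
        contradiction (trans (eq (here refl)) (sym (eq (there (here refl))))) x≢y

-- Darts and faces as orbits.

module Embedding (P : PlanarSTDigraph) where
  open PlanarSTDigraph P
  open Count graph

  D : Set
  D = Dart graph

  dir : D → Bool
  dir = proj₂

  at : D → Fin n
  at = vert graph

  opp : D → D
  opp = rev graph

  bool-split : ∀ b c → c ≡ b ⊎ c ≡ not b
  bool-split b c with c ≟ᵇ b
  ... | yes eq = inj₁ eq
  ... | no neq = inj₂ (¬-not neq)

  opp-opp : ∀ d → opp (opp d) ≡ d
  opp-opp (e , b) = cong (e ,_) (not-involutive b)

  dart-≡ : ∀ {d d′ : D} → proj₁ d ≡ proj₁ d′ → dir d ≡ dir d′ → d ≡ d′
  dart-≡ refl refl = refl

  σ-injective : Injective _≡_ _≡_ σ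
  σ-injective {d} {d′} eq = trans (sym (σ⁻¹σ d)) (trans (cong σ⁻¹ eq) (σ⁻¹σ d′))

  opp-injective : Injective _≡_ _≡_ opp
  opp-injective {d} {d′} eq = trans (sym (opp-opp d)) (trans (cong opp eq) (opp-opp d′))

  φ-injective : Injective _≡_ _≡_ φ
  φ-injective eq = opp-injective (σ-injective eq)

  φ⁻¹ : D → D
  φ⁻¹ d = opp (σ⁻¹ d)

  φφ⁻¹ : ∀ d → φ (φ⁻¹ d) ≡ d
  φφ⁻¹ d = trans (cong σ (opp-opp (σ⁻¹ d))) (σσ⁻¹ d)

  φ-opp : ∀ d → φ (opp d) ≡ σ d
  φ-opp d = cong σ (opp-opp d)

  σ⁻¹-vert : ∀ d → at (σ⁻¹ d) ≡ at d
  σ⁻¹-vert d = trans (sym (σ-vert (σ⁻¹ d))) (cong at (σσ⁻¹ d))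

  iter-σ-vert : ∀ k d → at (iter σ k d) ≡ at d
  iter-σ-vert zero    d = refl
  iter-σ-vert (suc k) d = trans (σ-vert _) (iter-σ-vert k d)

  index : D → Fin (m * 2)
  index (e , true)  = combine e (suc zero)
  index (e , false) = combine e zero

  index-injective : Injective _≡_ _≡_ index
  index-injective {e , true}  {e′ , true}  eq = cong (_, true) (proj₁ (combine-injective e _ e′ _ eq))
  index-injective {e , true}  {e′ , false} eq = contradiction (proj₂ (combine-injective e _ e′ _ eq)) λ ()
  index-injective {e , false} {e′ , true}  eq = contradiction (proj₂ (combine-injective e _ e′ _ eq)) λ ()
  index-injective {e , false} {e′ , false} eq = cong (_, false) (proj₁ (combine-injective e _ e′ _ eq))

  code-index : ∀ d → code graph d ≡ toℕ (index d)
  code-index (e , true)  = sym (toℕ-combine e (suc zero))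
  code-index (e , false) = sym (toℕ-combine e (zero {1}))

  code-injective : Injective _≡_ _≡_ (code graph)
  code-injective {d} {d′} eq =
    index-injective (toℕ-injective (trans (sym (code-index d)) (trans eq (code-index d′))))

  infix 4 _~_
  _~_ : D → D → Set
  x ~ y = ∃[ k ] iter φ k x ≡ y

  ~-refl : ∀ {x} → x ~ x
  ~-refl = 0 , refl

  ~-trans : ∀ {x y z} → x ~ y → y ~ z → x ~ z
  ~-trans {x} (j , refl) (k , refl) = k + j , iter-+ φ k j x

  ~-step : ∀ {x y} → φ x ≡ y → x ~ y
  ~-step eq = 1 , eq

  φ-period : ∀ x → ∃[ p ] (1 ≤ p × p ≤ m * 2 × iter φ p x ≡ x)
  φ-period = iter-period φ φ-injective index index-injective

  ~-bounded : ∀ {x y} → x ~ y → ∃[ r ] (r < 2 * m × iter φ r x ≡ y)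
  ~-bounded {x} (k , refl) with φ-period x
  ... | p , 1≤p , p≤ , per with iter-reduce φ p x 1≤p per k
  ...   | r , r<p , eq = r , <-≤-trans r<p (subst (p ≤_) (*-comm m 2) p≤) , eq

  ~-sym : ∀ {x y} → x ~ y → y ~ x
  ~-sym {x} (k , refl) with φ-period x
  ... | p , 1≤p , _ , per with iter-reduce φ p x 1≤p per k
  ...   | r , r<p , eq = p ∸ r , trans (cong (iter φ (p ∸ r)) (sym eq))
            (trans (sym (iter-+ φ (p ∸ r) r x)) (trans (cong (λ j → iter φ j x) (m∸n+n≡m (<⇒≤ r<p))) per))

  ~-opp-σ : ∀ d → opp d ~ σ d
  ~-opp-σ d = ~-step (φ-opp d)

  sameFace⇒~ : ∀ {x y} → sameFace x y ≡ true → x ~ y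
  sameFace⇒~ {x} {y} eq with satisfied (any⁻ _ (upTo (2 * m)) (Equivalence.from T-≡ eq))
  ... | k , p = k , T-does (_≟d_ graph (iter φ k x) y) p

  ~⇒sameFace : ∀ {x y} → x ~ y → sameFace x y ≡ true
  ~⇒sameFace {x} {y} x~y with ~-bounded x~y
  ... | k , k< , eq = Equivalence.to T-≡ (any⁺ _ (lose (∈-upTo⁺ k<) (Equivalence.from T-≡ (dec-true (_≟d_ graph _ y) eq))))

  Outer : D → Set
  Outer x = outer ~ x

  outer? : ∀ x → Dec (Outer x)
  outer? x with sameFace outer x in eq
  ... | true  = yes (sameFace⇒~ eq)
  ... | false = no λ out → contradiction (trans (sym (~⇒sameFace out)) eq) λ ()

  internal⇒¬outer : ∀ {x} → Internal x → ¬ Outer x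
  internal⇒¬outer int out = contradiction (trans (sym (~⇒sameFace out)) int) λ ()

  ¬outer⇒internal : ∀ {x} → ¬ Outer x → Internal x
  ¬outer⇒internal ¬out = ¬-not λ sf → ¬out (sameFace⇒~ sf)

  inner-~ : ∀ {x y} → x ~ y → ¬ Outer x → ¬ Outer y
  inner-~ x~y inner out = inner (~-trans out (~-sym x~y))

  -- Acyclicity and the turns of a face.

  -- Reachability, reversed for `false`, so that every dart ascends in the order of its own
  -- direction. One argument then serves sources and sinks alike.
  Lt : Bool → Fin n → Fin n → Set
  Lt true  u v = Reach⁺ graph u v
  Lt false u v = Reach⁺ graph v u

  reach-trans : ∀ {u v w} → Reach⁺ graph u v → Reach⁺ graph v w → Reach⁺ graph u w
  reach-trans (one e)    q = more e q
  reach-trans (more e p) q = more e (reach-trans p q)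

  Lt-trans : ∀ b {u v w} → Lt b u v → Lt b v w → Lt b u w
  Lt-trans true  p q = reach-trans p q
  Lt-trans false p q = reach-trans q p

  Lt-irrefl : ∀ b {u} → ¬ Lt b u u
  Lt-irrefl true  = acyclic _
  Lt-irrefl false = acyclic _

  Lt-dart : ∀ d → Lt (dir d) (at d) (at (opp d))
  Lt-dart (e , true)  = one e
  Lt-dart (e , false) = one e

  Lt-φ : ∀ z {b} → dir z ≡ b → dir (φ z) ≡ b →
         Lt b (at z) (at (φ z)) × Lt b (at (opp z)) (at (opp (φ z)))
  Lt-φ z refl eq = subst (Lt _ (at z)) (sym (σ-vert (opp z))) (Lt-dart z) ,
                   subst₂ (λ b v → Lt b v (at (opp (φ z)))) eq (σ-vert (opp z)) (Lt-dart (φ z))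

  -- As `φ z` is `σ (opp z)`, a turn at `z` is an angle at `opp z`.
  Turn : D → Set
  Turn z = dir (φ z) ≡ not (dir z)

  -- Following a face from x, the direction must eventually change, since
  -- otherwise the boundary of the face would be a directed cycle.
  run : ∀ x → ∃[ z ] (x ~ z × dir z ≡ dir x × Turn z ×
        (x ≡ z ⊎ (Lt (dir x) (at x) (at z) × Lt (dir x) (at (opp x)) (at (opp z)))))
  run x with bool-split (dir x) (dir (φ x))
  ... | inj₂ turn = x , ~-refl , refl , turn , inj₁ refl
  ... | inj₁ same with φ-period x
  ...   | suc p , _ , _ , per with iter-until φ Q Turn step (φ x) (same , Lt-φ x refl same) p
    where
    Q : D → Set
    Q z = dir z ≡ dir x × Lt (dir x) (at x) (at z) × Lt (dir x) (at (opp x)) (at (opp z))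
    step : ∀ z → Q z → Turn z ⊎ Q (φ z)
    step z (dz , lt , lt′) with bool-split (dir z) (dir (φ z))
    ... | inj₂ turn = inj₁ turn
    ... | inj₁ dφ with Lt-φ z dz (trans dφ dz)
    ...   | l , l′ = inj₂ (trans dφ dz , Lt-trans (dir x) lt l , Lt-trans (dir x) lt′ l′)
  ...     | inj₁ (j , (dz , lts) , turn) =
              iter φ j (φ x) , ~-trans (~-step refl) (j , refl) , dz , turn , inj₂ lts
  -- Without a turn the invariant survives a whole period, back to `x` itself.
  ...     | inj₂ (_ , lt , _) =
              ⊥-elim (Lt-irrefl (dir x) (subst (λ z → Lt (dir x) (at x) (at z)) (trans (iter-comm φ p x) per) lt))

  -- If `x` has the other direction, the dart after its first turn begins a run of direction `b`.
  turn-exists : ∀ b x → ∃[ z ] (x ~ z × dir z ≡ b × Turn z)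
  turn-exists b x with bool-split b (dir x) | run x
  ... | inj₁ dx | z , x~z , dz , turn , _ = z , x~z , trans dz dx , turn
  ... | inj₂ dx | z , x~z , dz , turn , _ with run (φ z)
  ...   | w , φz~w , dw , turn′ , _ = w , ~-trans x~z (~-trans (~-step refl) φz~w) ,
            trans dw (trans turn (trans (cong not (trans dz dx)) (not-involutive b))) , turn′

  -- The poles, angles and breaks.

  pole : Bool → Fin n
  pole true  = s
  pole false = t

  pole-dir : ∀ b {d} → at d ≡ pole b → dir d ≡ b
  pole-dir true  {e , true}  _  = refl
  pole-dir true  {e , false} eq = ⊥-elim (s-source (e , eq))
  pole-dir false {e , true}  eq = ⊥-elim (t-sink (e , eq))
  pole-dir false {e , false} _  = refl

  dart-exists : ∀ b {v} → ¬ v ≡ pole (not b) → ∃[ d ] (at d ≡ v × dir d ≡ b)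
  dart-exists true {v} v≢ with any? (λ e → tail e ≟ᶠ v)
  ... | yes (e , eq) = (e , true) , eq , refl
  ... | no none      = ⊥-elim (v≢ (t-unique v none))
  dart-exists false {v} v≢ with any? (λ e → head e ≟ᶠ v)
  ... | yes (e , eq) = (e , false) , eq , refl
  ... | no none      = ⊥-elim (v≢ (s-unique v none))

  pole-on-outer : ∀ b → ∃[ d ] (Outer d × at d ≡ pole b)
  pole-on-outer true with s-outer
  ... | d , sf , eq = d , sameFace⇒~ sf , eq
  pole-on-outer false with t-outer
  ... | d , sf , eq = d , sameFace⇒~ sf , eq

  Angle Break : D → Set
  Angle d = dir (σ d) ≡ dir d
  Break d = dir (σ d) ≡ not (dir d)

  -- Such a vertex has darts of both directions, and rotating from one of direction `b` to one of
  -- the other must cross a break.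
  break-exists : ∀ b {v} → ¬ v ≡ s → ¬ v ≡ t → ∃[ d ] (at d ≡ v × dir d ≡ b × Break d)
  break-exists b {v} v≢s v≢t with dart-exists b (v≢pole (not b)) | dart-exists (not b) (v≢pole (not (not b)))
    where
    v≢pole : ∀ c → ¬ v ≡ pole c
    v≢pole true  = v≢s
    v≢pole false = v≢t
  ... | d , refl , refl | d′ , at-d′ , dir-d′ with σ-cycle d d′ (sym at-d′)
  ...   | k , eq with iter-until σ (λ x → dir x ≡ dir d) Break step d refl k
    where
    step : ∀ x → dir x ≡ dir d → Break x ⊎ dir (σ x) ≡ dir d
    step x dx with bool-split (dir x) (dir (σ x))
    ... | inj₁ same = inj₂ (trans same dx)
    ... | inj₂ brk  = inj₁ brk
  ...     | inj₁ (j , dz , brk) = iter σ j d , iter-σ-vert j d , dz , brk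
  ...     | inj₂ dd = ⊥-elim (not-¬ (trans (cong dir (sym eq)) dd) dir-d′)

  -- Consequences of Euler's formula.

  rep : Fin faceCount → D
  rep = enum isRep

  rep-minimal : ∀ {r r′} → isRep r ≡ true → r ~ r′ → code graph r ≤ code graph r′
  rep-minimal {r} {r′} isR r~r′
    with All-lookup (All-all⁺ _ (allDarts graph) (Equivalence.from T-≡ isR)) (∈-allDarts r′)
  ... | h rewrite ~⇒sameFace r~r′ = ≤ᵇ⇒≤ _ _ h

  rep-unique : ∀ {i j} → rep i ~ rep j → i ≡ j
  rep-unique {i} {j} i~j = enum-injective isRep (code-injective (≤-antisym
    (rep-minimal (enum-sound isRep i) i~j) (rep-minimal (enum-sound isRep j) (~-sym i~j))))

  -- Every vertex other than s and t has a break and every face an angle, and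
  -- breaks and angles of direction b are distinct edges; by Euler's formula
  -- these edges are all the edges, so no vertex (face) has a second one.
  module Saturation (b : Bool) {F : ℕ} (faces : n + F ≡ m + 2) (rep : Fin F → D)
                    (rep-unique : ∀ {i j} → rep i ~ rep j → i ≡ j) where

    -- The 2 of Euler's formula makes room for `s` and `t`, which have no break.
    Placed : Fin n ⊎ Fin F → Fin m ⊎ Fin 2 → Set
    Placed (inj₁ v) (inj₁ e)          = at (e , b) ≡ v × Break (e , b)
    Placed (inj₁ v) (inj₂ zero)       = v ≡ s
    Placed (inj₁ v) (inj₂ (suc zero)) = v ≡ t
    Placed (inj₂ i) (inj₁ e)          = Angle (e , b) × opp (e , b) ~ rep i
    Placed (inj₂ i) (inj₂ _)          = ⊥

    place : ∀ x → ∃[ y ] Placed x y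
    place (inj₁ v) with v ≟ᶠ s | v ≟ᶠ t
    ... | yes v≡s | _       = inj₂ zero , v≡s
    ... | no _    | yes v≡t = inj₂ (suc zero) , v≡t
    ... | no v≢s  | no v≢t with break-exists b v≢s v≢t
    ...   | (e , _) , at-d , refl , brk = inj₁ e , at-d , brk
    -- An angle at a dart of direction `b` is a turn at its reversal, hence a turn of direction
    -- `not b`.
    place (inj₂ i) with turn-exists (not b) (rep i)
    ... | z@(e , _) , i~z , refl , turn = inj₁ e ,
      trans (cong (λ c → dir (σ (e , c))) (sym (not-involutive b))) (trans turn (not-involutive b)) ,
      ~-sym i~z

    placed-injective : ∀ {x x′} y → Placed x y → Placed x′ y → x ≡ x′
    placed-injective {inj₁ _} {inj₁ _} (inj₁ e) (refl , _) (refl , _) = refl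
    placed-injective {inj₁ _} {inj₂ _} (inj₁ e) (_ , brk) (ang , _) = ⊥-elim (not-¬ ang brk)
    placed-injective {inj₂ _} {inj₁ _} (inj₁ e) (ang , _) (_ , brk) = ⊥-elim (not-¬ ang brk)
    placed-injective {inj₂ _} {inj₂ _} (inj₁ e) (_ , p) (_ , q) =
      cong inj₂ (rep-unique (~-trans (~-sym p) q))
    placed-injective {inj₁ _} {inj₁ _} (inj₂ zero) refl refl = refl
    placed-injective {inj₁ _} {inj₁ _} (inj₂ (suc zero)) refl refl = refl

    g : Fin (n + F) → Fin (m + 2)
    g k = join m 2 (proj₁ (place (splitAt n k)))

    g-injective : Injective _≡_ _≡_ g
    g-injective {j} {k} eq = trans (sym (join-splitAt n F j))
      (trans (cong (join n F)
        (placed-injective _ (proj₂ (place (splitAt n j)))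
          (subst (Placed _) (sym same) (proj₂ (place (splitAt n k))))))
      (join-splitAt n F k))
      where
      same : proj₁ (place (splitAt n j)) ≡ proj₁ (place (splitAt n k))
      same = trans (sym (splitAt-join m 2 _)) (trans (cong (splitAt m) eq) (splitAt-join m 2 _))

    covered : ∀ e → ∃[ x ] (proj₁ (place x) ≡ inj₁ e)
    covered e with injective⇒surjective faces g g-injective (join m 2 (inj₁ e))
    ... | k , eq = splitAt n k ,
      trans (sym (splitAt-join m 2 _)) (trans (cong (splitAt m) eq) (splitAt-join m 2 (inj₁ e)))

    covered-Placed : ∀ e → ∃[ x ] (proj₁ (place x) ≡ inj₁ e × Placed x (inj₁ e))
    covered-Placed e with covered e
    ... | x , eq = x , eq , subst (Placed x) eq (proj₂ (place x))

    same-edge : ∀ x {e e′} → proj₁ (place x) ≡ inj₁ e → proj₁ (place x) ≡ inj₁ e′ → e ≡ e′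
    same-edge x p q with trans (sym p) q
    ... | refl = refl

    angle-edge-unique : ∀ e e′ → Angle (e , b) → Angle (e′ , b) → opp (e , b) ~ opp (e′ , b) → e ≡ e′
    angle-edge-unique e e′ ang ang′ e~e′ with covered-Placed e | covered-Placed e′
    ... | inj₁ _ , _ , _ , brk | _ = ⊥-elim (not-¬ ang brk)
    ... | inj₂ _ , _ | inj₁ _ , _ , _ , brk = ⊥-elim (not-¬ ang′ brk)
    ... | inj₂ i , p , _ , e~i | inj₂ j , q , _ , e′~j
      with rep-unique {i} {j} (~-trans (~-sym e~i) (~-trans e~e′ e′~j))
    ...   | refl = same-edge (inj₂ i) p q

    break-edge-unique : ∀ e e′ → Break (e , b) → Break (e′ , b) → at (e , b) ≡ at (e′ , b) → e ≡ e′
    break-edge-unique e e′ brk brk′ eq with covered-Placed e | covered-Placed e′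
    ... | inj₂ _ , _ , ang , _ | _ = ⊥-elim (not-¬ ang brk)
    ... | inj₁ _ , _ | inj₂ _ , _ , ang , _ = ⊥-elim (not-¬ ang brk′)
    ... | inj₁ v , p , at-e , _ | inj₁ w , q , at-e′ , _ with trans (sym at-e) (trans eq at-e′)
    ...   | refl = same-edge (inj₁ v) p q

  angle-unique : ∀ {d d′} → Angle d → Angle d′ → dir d ≡ dir d′ → opp d ~ opp d′ → d ≡ d′
  angle-unique {e , b} {e′ , .b} ang ang′ refl d~d′ =
    cong (_, b) (Saturation.angle-edge-unique b euler rep rep-unique e e′ ang ang′ d~d′)

  break-unique : ∀ {d d′} → Break d → Break d′ → dir d ≡ dir d′ → at d ≡ at d′ → d ≡ d′
  break-unique {e , b} {e′ , .b} brk brk′ refl eq =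
    cong (_, b) (Saturation.break-edge-unique b euler rep rep-unique e e′ brk brk′ eq)

  turn-unique : ∀ {z z′} → Turn z → Turn z′ → dir z ≡ dir z′ → z ~ z′ → z ≡ z′
  turn-unique {z} {z′} turn turn′ dd z~z′ = opp-injective
    (angle-unique turn turn′ (cong not dd) (subst₂ _~_ (sym (opp-opp z)) (sym (opp-opp z′)) z~z′))

  -- Angles of internal faces.

  -- The gap from `d` to `σ d` lies in the face of `opp d`. Among the darts of one direction at a
  -- vertex, exactly one is not good, by `last-exists` and `last-unique`.
  Good : D → Set
  Good d = Angle d × ¬ Outer (opp d)

  good? : ∀ d → Dec (Good d)
  good? d = (dir (σ d) ≟ᵇ dir d) ×-dec ¬? (outer? (opp d))

  ¬good : ∀ {d} → ¬ Good d → Break d ⊎ (Angle d × Outer (opp d))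
  ¬good {d} bad with bool-split (dir d) (dir (σ d))
  ... | inj₂ brk = inj₁ brk
  ... | inj₁ ang with outer? (opp d)
  ...   | no inner = ⊥-elim (bad (ang , inner))
  ...   | yes out  = inj₂ (ang , out)

  -- The outer face passes through the pole, where all darts have the same direction, so the gap it
  -- passes is an angle.
  pole-angle : ∀ b → ∃[ d ] (at d ≡ pole b × dir d ≡ b × Angle d × Outer (opp d))
  pole-angle b with pole-on-outer b
  ... | d₀ , out , at-d₀ =
    σ⁻¹ d₀ , at-d , pole-dir b at-d ,
    trans (cong dir (σσ⁻¹ d₀)) (trans (pole-dir b at-d₀) (sym (pole-dir b at-d))) ,
    ~-trans out (~-sym (subst (opp (σ⁻¹ d₀) ~_) (σσ⁻¹ d₀) (~-opp-σ (σ⁻¹ d₀))))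
    where
    at-d : at (σ⁻¹ d₀) ≡ pole b
    at-d = trans (σ⁻¹-vert d₀) at-d₀

  outer-angle-at-pole : ∀ {d} → Angle d → Outer (opp d) → at d ≡ pole (dir d)
  outer-angle-at-pole {d} ang out with pole-angle (dir d)
  ... | d₁ , at-d₁ , dir-d₁ , ang₁ , out₁ =
    trans (cong at (angle-unique ang ang₁ (sym dir-d₁) (~-trans (~-sym out) out₁))) at-d₁

  -- At `pole b` this is the angle of the outer face, elsewhere a break.
  last-exists : ∀ b {v} → ¬ v ≡ pole (not b) → ∃[ d ] (at d ≡ v × dir d ≡ b × ¬ Good d)
  last-exists b {v} v≢ with v ≟ᶠ pole b
  ... | yes refl with pole-angle b
  ...   | d , at-d , dir-d , _ , out = d , at-d , dir-d , λ good → proj₂ good out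
  last-exists b {v} v≢ | no v≢′ with break-exists b (v≢s b v≢ v≢′) (v≢t b v≢ v≢′)
    where
    v≢s : ∀ b → ¬ v ≡ pole (not b) → ¬ v ≡ pole b → ¬ v ≡ s
    v≢s true  _ p = p
    v≢s false p _ = p
    v≢t : ∀ b → ¬ v ≡ pole (not b) → ¬ v ≡ pole b → ¬ v ≡ t
    v≢t true  p _ = p
    v≢t false _ p = p
  ...   | d , at-d , dir-d , brk = d , at-d , dir-d , λ good → not-¬ (proj₁ good) brk

  no-break-at-pole : ∀ {d} → Break d → ¬ at d ≡ pole (dir d)
  no-break-at-pole {d} brk at-d = not-¬ (pole-dir (dir d) (trans (σ-vert d) at-d)) brk

  -- The two ways of not being good never mix: a pole has no break, and the outer face has its
  -- angles only at the poles.
  last-unique : ∀ {d d′} → ¬ Good d → ¬ Good d′ → dir d ≡ dir d′ → at d ≡ at d′ → d ≡ d′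
  last-unique {d} {d′} bad bad′ dd at≡ with ¬good bad | ¬good bad′
  ... | inj₁ brk | inj₁ brk′ = break-unique brk brk′ dd at≡
  ... | inj₁ brk | inj₂ (ang′ , out′) = ⊥-elim (no-break-at-pole brk
          (trans at≡ (trans (outer-angle-at-pole ang′ out′) (cong pole (sym dd)))))
  ... | inj₂ (ang , out) | inj₁ brk′ = ⊥-elim (no-break-at-pole brk′
          (trans (sym at≡) (trans (outer-angle-at-pole ang out) (cong pole dd))))
  ... | inj₂ (ang , out) | inj₂ (ang′ , out′) = angle-unique ang ang′ dd (~-trans (~-sym out) out′)

  -- Lengths of the sides of a face.

  onSide : Bool → D → D → Bool
  onSide true  x y = sameFace x y ∧ dir y
  onSide false x y = sameFace x y ∧ not (dir y)

  sideLen : Bool → D → ℕ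
  sideLen b x = countDarts graph (onSide b x)

  onSide-intro : ∀ {x y} → x ~ y → onSide (dir y) x y ≡ true
  onSide-intro {x} {e , true}  x~y rewrite ~⇒sameFace x~y = refl
  onSide-intro {x} {e , false} x~y rewrite ~⇒sameFace x~y = refl

  onSide-elim : ∀ b {x y} → onSide b x y ≡ true → x ~ y × dir y ≡ b
  onSide-elim true {x} {y} eq with Equivalence.to (T-∧ {sameFace x y}) (Equivalence.from T-≡ eq)
  ... | p , q = sameFace⇒~ (Equivalence.to T-≡ p) , Equivalence.to T-≡ q
  onSide-elim false {x} {y} eq with Equivalence.to (T-∧ {sameFace x y}) (Equivalence.from T-≡ eq)
  ... | p , q = sameFace⇒~ (Equivalence.to T-≡ p) , not-injective (Equivalence.to T-≡ q)

  φ-irrefl : ∀ y → ¬ y ≡ φ y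
  φ-irrefl y eq = Lt-irrefl (dir y) (subst (Lt (dir y) (at y))
    (trans (sym (σ-vert (opp y))) (cong at (sym eq))) (Lt-dart y))

  side-long : ∀ {x y} → x ~ y → dir (φ y) ≡ dir y → 2 ≤ sideLen (dir y) x
  side-long {x} {y} x~y eq = count≥2 (onSide (dir y) x) (onSide-intro x~y)
    (subst (λ b → onSide b x (φ y) ≡ true) eq (onSide-intro (~-trans x~y (~-step refl)))) (φ-irrefl y)

  -- After `y` the face runs in the other direction and can turn back only at `φ⁻¹ y`, by
  -- `turn-unique`. So it returns to `y` without meeting another dart of the direction of `y`.
  side-single : ∀ {x y} → x ~ y → Turn y → dir (φ⁻¹ y) ≡ not (dir y) → sideLen (dir y) x ≡ 1
  side-single {x} {y} x~y turn before = count≡1 (onSide (dir y) x) (onSide-intro x~y) only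
    where
    Q : D → Set
    Q z = y ~ z × (z ≡ y ⊎ dir z ≡ not (dir y))
    turn-before : Turn (φ⁻¹ y)
    turn-before = trans (cong dir (φφ⁻¹ y)) (trans (sym (not-involutive (dir y))) (cong not (sym before)))
    step : ∀ z → Q z → ⊥ ⊎ Q (φ z)
    step z (y~z , inj₁ refl) = inj₂ (~-trans y~z (~-step refl) , inj₂ turn)
    step z (y~z , inj₂ dz) with bool-split (dir z) (dir (φ z))
    ... | inj₁ same = inj₂ (~-trans y~z (~-step refl) , inj₂ (trans same dz))
    ... | inj₂ turn-z = inj₂ (~-trans y~z (~-step refl) , inj₁ (trans (cong φ
            (turn-unique turn-z turn-before (trans dz (sym before)) (~-trans (~-sym y~z) (~-sym (~-step (φφ⁻¹ y))))))
            (φφ⁻¹ y)))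
    only : ∀ y′ → onSide (dir y) x y′ ≡ true → y′ ≡ y
    only y′ on with onSide-elim (dir y) on
    ... | x~y′ , dy′ with ~-trans (~-sym x~y) x~y′
    ...   | k , refl with iter-until φ Q (λ _ → ⊥) step y (~-refl , inj₁ refl) k
    ...     | inj₂ (_ , inj₁ eq) = eq
    ...     | inj₂ (_ , inj₂ neq) = ⊥-elim (not-¬ dy′ neq)

  -- Chords and rhombi.

  -- Chord d: d is the whole of its side of the internal face at opp d.
  Chord : D → Set
  Chord d = ¬ Outer (opp d) × Angle d × dir (σ⁻¹ (opp d)) ≡ not (dir d)

  chord? : ∀ d → Dec (Chord d)
  chord? d = ¬? (outer? (opp d)) ×-dec
    ((dir (σ d) ≟ᵇ dir d) ×-dec (dir (σ⁻¹ (opp d)) ≟ᵇ not (dir d)))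

  -- Not a chord of either adjacent face; in the absence of rhombi these become the path edges.
  Special : D → Set
  Special d = ¬ Chord d × ¬ Chord (opp d)

  chord⇒good : ∀ {d} → Chord d → Good d
  chord⇒good (inner , ang , _) = ang , inner

  -- At an angle, `d` and `σ d` lie on the two sides of the face between them; `Chord d` and
  -- `Chord (opp (σ d))` say of one or the other that it is its whole side.
  opp-chord⇒good : ∀ {d} → Chord (opp (σ d)) → Good d
  opp-chord⇒good {d} (inner , _ , eq) =
    trans (sym (not-involutive (dir (σ d))))
      (trans (sym eq) (cong dir (trans (cong σ⁻¹ (opp-opp (σ d))) (σ⁻¹σ d)))) ,
    inner-~ (~-sym (~-opp-σ d)) (subst (λ x → ¬ Outer x) (opp-opp (σ d)) inner)

  opp-chord : ∀ {d} → Good d → Turn (σ d) → Chord (opp (σ d))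
  opp-chord {d} (ang , inner) turn =
    subst (λ x → ¬ Outer x) (sym (opp-opp (σ d))) (inner-~ (~-opp-σ d) inner) , turn ,
    trans (cong dir (trans (cong σ⁻¹ (opp-opp (σ d))) (σ⁻¹σ d)))
      (trans (sym ang) (sym (not-involutive (dir (σ d)))))

  parallel-unique : ∀ {d d′} → dir d ≡ dir d′ → at d ≡ at d′ → at (opp d) ≡ at (opp d′) → d ≡ d′
  parallel-unique {e , true}  {e′ , .true}  refl p q = cong (_, true) (simple e e′ p q)
  parallel-unique {e , false} {e′ , .false} refl p q = cong (_, false) (simple e e′ q p)

  -- A vertex with a single dart lacks one direction, so it is a pole, and its only gap is the one
  -- in the outer face.
  isolated-outer : ∀ {d} → σ d ≡ d → Outer (opp d)
  isolated-outer {d} fix with at d ≟ᶠ pole (not (not (dir d)))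
  ... | no at≢ with dart-exists (not (dir d)) at≢
  ...   | d′ , at-d′ , dir-d′ with σ-cycle d d′ (sym at-d′)
  ...     | k , eq = ⊥-elim (not-¬ (cong dir (trans (sym eq) (iter-fixed σ fix k))) dir-d′)
  isolated-outer {d} fix | yes at≡ with pole-on-outer (not (not (dir d)))
  ... | d₀ , out , at-d₀ with σ-cycle d d₀ (trans at≡ (sym at-d₀))
  ...   | k , eq = ~-trans out (~-sym (subst (opp d ~_) (trans fix (trans (sym (iter-fixed σ fix k)) eq)) (~-opp-σ d)))

  -- A face with a single edge on both sides has parallel edges, so G is one edge.
  chord-exclusive : ∀ {d} → Chord d → ¬ Chord (opp (σ d))
  chord-exclusive {d} (inner , ang , before) (_ , turn , _) = inner (isolated-outer σd≡d)
    where
    x≡σd : φ⁻¹ (opp d) ≡ σ d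
    x≡σd = turn-unique
      (trans (cong dir (φφ⁻¹ (opp d))) (trans (sym before) (sym (not-involutive _))))
      turn
      (trans (cong not before) (trans (not-involutive (dir d)) (sym ang)))
      (~-trans (~-step (φφ⁻¹ (opp d))) (~-opp-σ d))
    σd≡d : σ d ≡ d
    σd≡d = parallel-unique ang (σ-vert d)
      (trans (sym (σ-vert (opp (σ d)))) (cong at (trans (cong φ (sym x≡σd)) (φφ⁻¹ (opp d)))))

  chord-single : ∀ {d} → Chord d → sideLen (dir (opp d)) (opp d) ≡ 1
  chord-single {d} (inner , ang , before) = side-single ~-refl
    (trans (cong dir (φ-opp d)) (trans ang (sym (not-involutive (dir d)))))
    (cong not before)

  chord-long : ∀ {d} → Chord d → 2 ≤ sideLen (dir d) (opp d)
  chord-long {d} ch@(inner , ang , _) with bool-split (dir (σ d)) (dir (φ (σ d)))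
  ... | inj₁ same = subst (λ b → 2 ≤ sideLen b (opp d)) ang (side-long (~-opp-σ d) same)
  ... | inj₂ turn = ⊥-elim (chord-exclusive ch (opp-chord (chord⇒good ch) turn))

  -- Scan around `v` from just after the dart `ℓ` that is not good. The first dart is no chord of
  -- the face behind it. While each dart is a chord of the face ahead, the next is none of the face
  -- behind, by `chord-exclusive`. At `ℓ` there is no chord ahead, so a special dart is met at the
  -- latest there.
  special-exists : ∀ b {v} → ¬ v ≡ pole (not b) → ∃[ d ] (at d ≡ v × dir d ≡ b × Special d)
  special-exists b {v} v≢ with last-exists b v≢
  ... | ℓ , refl , refl , bad with σ-cycle (σ ℓ) ℓ (σ-vert ℓ)
  ...   | k , eq with iter-until σ Q (λ d → dir d ≡ dir ℓ × Special d) step (σ ℓ) (λ _ ch → bad (opp-chord⇒good ch)) k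
    where
    Q : D → Set
    Q d = dir d ≡ dir ℓ → ¬ Chord (opp d)
    step : ∀ d → Q d → (dir d ≡ dir ℓ × Special d) ⊎ Q (σ d)
    step d q with dir d ≟ᵇ dir ℓ | chord? d
    ... | no neq | _      = inj₂ (λ dσ ch → neq (trans (sym (proj₁ (opp-chord⇒good ch))) dσ))
    ... | yes dd | yes ch = inj₂ (λ _ → chord-exclusive ch)
    ... | yes dd | no ¬ch = inj₁ (dd , ¬ch , q dd)
  ...     | inj₁ (j , _ , dd , sp) = iter σ j (σ ℓ) , trans (iter-σ-vert j (σ ℓ)) (σ-vert ℓ) , dd , sp
  ...     | inj₂ q = ℓ , refl , refl , (bad ∘ chord⇒good) , subst (λ d → dir d ≡ dir ℓ → ¬ Chord (opp d)) eq q refl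

  strong-rhombus : ∀ d → Chord d → Chord (opp d) → StrongRhombus P
  strong-rhombus (e , true) left right = e ,
    (¬outer⇒internal (proj₁ left) , chord-single left , chord-long left) ,
    (¬outer⇒internal (proj₁ right) , chord-single right , chord-long right)
  strong-rhombus (e , false) right left = strong-rhombus (e , true) left right

  weak-rhombus : ∀ {d} → Good d → ¬ Chord d → ¬ Chord (opp (σ d)) → WeakRhombus P
  weak-rhombus {d} (ang , inner) ¬ch ¬ch′ = opp d , ¬outer⇒internal inner , both (dir d) long long′
    where
    both : ∀ b → 2 ≤ sideLen b (opp d) → 2 ≤ sideLen (not b) (opp d) →
           2 ≤ leftLen (opp d) × 2 ≤ rightLen (opp d)
    both true  p q = p , q
    both false p q = q , p
    long : 2 ≤ sideLen (dir d) (opp d)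
    long with bool-split (dir (σ d)) (dir (φ (σ d)))
    ... | inj₁ same = subst (λ b → 2 ≤ sideLen b (opp d)) ang (side-long (~-opp-σ d) same)
    ... | inj₂ turn = ⊥-elim (¬ch′ (opp-chord (ang , inner) turn))
    long′ : 2 ≤ sideLen (not (dir d)) (opp d)
    long′ with bool-split (dir d) (dir (σ⁻¹ (opp d)))
    ... | inj₂ eq = ⊥-elim (¬ch (inner , ang , eq))
    ... | inj₁ eq = subst (λ b → 2 ≤ sideLen b (opp d)) (cong not eq)
            (side-long (~-sym (~-step (φφ⁻¹ (opp d))))
              (trans (cong dir (φφ⁻¹ (opp d))) (cong not (sym eq))))

  -- From the absence of rhombi to a hamiltonian path.

  module NoRhombus (¬strong : ¬ StrongRhombus P) (¬weak : ¬ WeakRhombus P) where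

    chord-of-angle : ∀ {d} → Good d → Chord d ⊎ Chord (opp (σ d))
    chord-of-angle {d} good with chord? d | chord? (opp (σ d))
    ... | yes ch | _       = inj₁ ch
    ... | no _   | yes ch  = inj₂ ch
    ... | no ¬ch | no ¬ch′ = ⊥-elim (¬weak (weak-rhombus good ¬ch ¬ch′))

    -- Sending each good angle to the chord of its face, and the one remaining edge
    -- at each vertex to a special edge there, is injective on the edges, hence
    -- onto; so a vertex has no second special edge.
    module Matching (b : Bool) where

      Matched : Fin m → Fin m → Set
      Matched e e′ = (Good (e , b) × Chord (e , b) × e′ ≡ e)
                   ⊎ (Good (e , b) × ¬ Chord (e , b) × (e′ , b) ≡ σ (e , b))
                   ⊎ (¬ Good (e , b) × at (e′ , b) ≡ at (e , b) × Special (e′ , b))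

      match : ∀ e → ∃[ e′ ] Matched e e′
      match e with good? (e , b) | chord? (e , b)
      ... | yes good | yes ch = e , inj₁ (good , ch , refl)
      ... | yes good | no ¬ch = proj₁ (σ (e , b)) , inj₂ (inj₁ (good , ¬ch , dart-≡ refl (sym (proj₁ good))))
      ... | no bad   | _ with special-exists b {at (e , b)} (λ eq → not-¬ refl (pole-dir (not b) eq))
      ...   | (e′ , _) , at-e′ , refl , sp = e′ , inj₂ (inj₂ (bad , at-e′ , sp))

      next-chord : ∀ {e e′} → Good (e , b) → ¬ Chord (e , b) → (e′ , b) ≡ σ (e , b) → Chord (opp (e′ , b))
      next-chord good ¬ch eq with chord-of-angle good
      ... | inj₁ ch = ⊥-elim (¬ch ch)
      ... | inj₂ ch = subst (λ x → Chord (opp x)) (sym eq) ch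

      matched-injective : ∀ {e₁ e₂} e → Matched e₁ e → Matched e₂ e → e₁ ≡ e₂
      matched-injective e (inj₁ (_ , _ , refl)) (inj₁ (_ , _ , refl)) = refl
      matched-injective e (inj₁ (_ , ch , refl)) (inj₂ (inj₁ (g , ¬ch , eq))) =
        ⊥-elim (¬strong (strong-rhombus (e , b) ch (next-chord g ¬ch eq)))
      matched-injective e (inj₁ (_ , ch , refl)) (inj₂ (inj₂ (_ , _ , sp))) = ⊥-elim (proj₁ sp ch)
      matched-injective e (inj₂ (inj₁ (g , ¬ch , eq))) (inj₁ (_ , ch , refl)) =
        ⊥-elim (¬strong (strong-rhombus (e , b) ch (next-chord g ¬ch eq)))
      matched-injective e (inj₂ (inj₁ (_ , _ , eq))) (inj₂ (inj₁ (_ , _ , eq′))) =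
        cong proj₁ (σ-injective (trans (sym eq) eq′))
      matched-injective e (inj₂ (inj₁ (g , ¬ch , eq))) (inj₂ (inj₂ (_ , _ , sp))) =
        ⊥-elim (proj₂ sp (next-chord g ¬ch eq))
      matched-injective e (inj₂ (inj₂ (_ , _ , sp))) (inj₁ (_ , ch , refl)) = ⊥-elim (proj₁ sp ch)
      matched-injective e (inj₂ (inj₂ (_ , _ , sp))) (inj₂ (inj₁ (g , ¬ch , eq))) =
        ⊥-elim (proj₂ sp (next-chord g ¬ch eq))
      matched-injective e (inj₂ (inj₂ (bad , at₁ , _))) (inj₂ (inj₂ (bad′ , at₂ , _))) =
        cong proj₁ (last-unique bad bad′ refl (trans (sym at₁) at₂))

      matched-special : ∀ {e₁ e} → Matched e₁ e → Special (e , b) → ¬ Good (e₁ , b) × at (e , b) ≡ at (e₁ , b)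
      matched-special (inj₁ (_ , ch , refl)) sp = ⊥-elim (proj₁ sp ch)
      matched-special (inj₂ (inj₁ (g , ¬ch , eq))) sp = ⊥-elim (proj₂ sp (next-chord g ¬ch eq))
      matched-special (inj₂ (inj₂ (bad , at≡ , _))) sp = bad , at≡

      match-surjective : ∀ e → ∃[ e₁ ] proj₁ (match e₁) ≡ e
      match-surjective = injective⇒surjective refl (λ e → proj₁ (match e))
        λ {e₁} {e₂} eq → matched-injective _ (subst (Matched e₁) eq (proj₂ (match e₁))) (proj₂ (match e₂))

      special-unique : ∀ {e e′} → Special (e , b) → Special (e′ , b) → at (e , b) ≡ at (e′ , b) → e ≡ e′
      special-unique {e} {e′} sp sp′ at≡ with match-surjective e | match-surjective e′
      ... | e₁ , refl | e₂ , refl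
        with matched-special (proj₂ (match e₁)) sp | matched-special (proj₂ (match e₂)) sp′
      ...   | bad , at₁ | bad′ , at₂ = cong (λ x → proj₁ (match (proj₁ x)))
              (last-unique bad bad′ refl (trans (sym at₁) (trans at≡ at₂)))

    -- The special edges, closed up by a jump from `t` to `s` so that `π` becomes a permutation.
    Next : Fin n → Fin n → Set
    Next v w = (v ≡ t × w ≡ s) ⊎ (∃[ e ] (tail e ≡ v × head e ≡ w × Special (e , true)))

    next : ∀ v → ∃[ w ] Next v w
    next v with v ≟ᶠ t
    ... | yes v≡t = s , inj₁ (v≡t , refl)
    ... | no v≢t with special-exists true v≢t
    ...   | (e , _) , refl , refl , sp = head e , inj₂ (e , refl , refl , sp)

    next-injective : ∀ {v v′ w} → Next v w → Next v′ w → v ≡ v′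
    next-injective (inj₁ (refl , _)) (inj₁ (refl , _)) = refl
    next-injective (inj₁ (_ , refl)) (inj₂ (e , _ , eq , _)) = ⊥-elim (s-source (e , eq))
    next-injective (inj₂ (e , _ , eq , _)) (inj₁ (_ , refl)) = ⊥-elim (s-source (e , eq))
    -- Being special is symmetric under reversal, so both edges are special as in-darts of the
    -- common head.
    next-injective (inj₂ (e , refl , eq , ¬ch , ¬ch′)) (inj₂ (e′ , refl , eq′ , ¬ch″ , ¬ch‴)) =
      cong tail (Matching.special-unique false (¬ch′ , ¬ch) (¬ch‴ , ¬ch″) (trans eq (sym eq′)))

    π : Fin n → Fin n
    π v = proj₁ (next v)

    π-injective : Injective _≡_ _≡_ π
    π-injective {v} {v′} eq = next-injective (subst (Next v) eq (proj₂ (next v))) (proj₂ (next v′))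

    next-from-t : ∀ {w} → Next t w → w ≡ s
    next-from-t (inj₁ (_ , eq)) = eq
    next-from-t (inj₂ (e , eq , _)) = ⊥-elim (t-sink (e , eq))

    edge-reach : ∀ {e v w} → tail e ≡ v → head e ≡ w → Reach⁺ graph v w
    edge-reach {e} refl refl = one e

    -- The orbit of `v` is periodic; if it avoided `t`, it would follow edges around a directed
    -- cycle.
    returns : ∀ v → ∃[ k ] iter π k v ≡ s
    returns v with proj₂ (next v)
    ... | inj₁ (_ , eq) = 1 , eq
    ... | inj₂ (e , p , q , _) with iter-period π π-injective id id v
    ...   | suc r , _ , _ , per with iter-until π (Reach⁺ graph v) (_≡ t) step (π v) (edge-reach p q) r
      where
      step : ∀ x → Reach⁺ graph v x → x ≡ t ⊎ Reach⁺ graph v (π x)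
      step x v→x with proj₂ (next x)
      ... | inj₁ (eq , _) = inj₁ eq
      ... | inj₂ (e , p , q , _) = inj₂ (reach-trans v→x (edge-reach p q))
    ...     | inj₁ (j , _ , eq) = suc (suc j) , trans (cong π (trans (sym (iter-comm π j v)) eq)) (next-from-t (proj₂ (next t)))
    ...     | inj₂ cyc = ⊥-elim (acyclic v (subst (Reach⁺ graph v) (trans (iter-comm π r v) per) cyc))

    distinct : ∀ {i j} → i < j → j < n → ¬ iter π i s ≡ iter π j s
    distinct = cycle-injective π π-injective s returns

    path : Fin n → Fin n
    path i = iter π (toℕ i) s

    path-injective : Injective _≡_ _≡_ path
    path-injective {i} {j} eq with toℕ i <? toℕ j | toℕ j <? toℕ i
    ... | yes i<j | _       = ⊥-elim (distinct i<j (toℕ<n j) eq)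
    ... | no _    | yes j<i = ⊥-elim (distinct j<i (toℕ<n i) (sym eq))
    ... | no i≮j  | no j≮i  = toℕ-injective (≤-antisym (≮⇒≥ j≮i) (≮⇒≥ i≮j))

    path-edge : ∀ i j → toℕ j ≡ suc (toℕ i) → ∃[ e ] (tail e ≡ path i × head e ≡ path j)
    path-edge i j eq with proj₂ (next (path i))
    -- The jump to `s` would close the cycle after fewer than `n` steps.
    ... | inj₁ (_ , π≡s) = ⊥-elim (distinct {0} {suc (toℕ i)} (s≤s z≤n) (subst (_< n) eq (toℕ<n j)) (sym π≡s))
    ... | inj₂ (e , p , q , _) = e , p , trans q (cong (λ k → iter π k s) (sym eq))

    hamiltonian : HamiltonianPath graph
    hamiltonian = path , path-injective , path-edge

  -- Ranks along a hamiltonian path.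

  module Path (p : Fin n → Fin n) (p-injective : Injective _≡_ _≡_ p)
              (p-edge : ∀ i j → toℕ j ≡ suc (toℕ i) → ∃[ e ] (tail e ≡ p i × head e ≡ p j)) where

    pos : Fin n → Fin n
    pos v = proj₁ (injective⇒surjective refl p p-injective v)

    p-pos : ∀ v → p (pos v) ≡ v
    p-pos v = proj₂ (injective⇒surjective refl p p-injective v)

    rank : Fin n → ℕ
    rank v = toℕ (pos v)

    rank-p : ∀ i → rank (p i) ≡ toℕ i
    rank-p i = cong toℕ (p-injective (p-pos (p i)))

    rank-injective : ∀ {v w} → rank v ≡ rank w → v ≡ w
    rank-injective {v} {w} eq = trans (sym (p-pos v)) (trans (cong p (toℕ-injective eq)) (p-pos w))

    p-reach : ∀ k i j → toℕ j ≡ suc (k + toℕ i) → Reach⁺ graph (p i) (p j)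
    p-reach zero i j eq with p-edge i j eq
    ... | e , tl , hd = subst₂ (Reach⁺ graph) tl hd (one e)
    p-reach (suc k) i j eq = reach-trans (p-reach zero i i⁺ to-i⁺)
      (p-reach k i⁺ j (trans eq (cong suc (trans (sym (+-suc k (toℕ i))) (cong (k +_) (sym to-i⁺))))))
      where
      i⁺<n : suc (toℕ i) < n
      i⁺<n = ≤-<-trans (subst (suc (toℕ i) ≤_) (sym eq) (s≤s (m≤n⇒m≤1+n (m≤n+m (toℕ i) k)))) (toℕ<n j)
      i⁺ : Fin n
      i⁺ = fromℕ< i⁺<n
      to-i⁺ : toℕ i⁺ ≡ suc (toℕ i)
      to-i⁺ = toℕ-fromℕ< i⁺<n

    rank-reach : ∀ {u v} → rank u < rank v → Reach⁺ graph u v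
    rank-reach {u} {v} u<v = subst₂ (Reach⁺ graph) (p-pos u) (p-pos v)
      (p-reach (rank v ∸ suc (rank u)) (pos u) (pos v)
        (trans (sym (m∸n+n≡m u<v)) (+-suc _ (rank u))))

    -- The path makes vertices of different rank comparable by reachability, so acyclicity forces
    -- the two orders to agree.
    reach-rank : ∀ {u v} → Reach⁺ graph u v → rank u < rank v
    reach-rank {u} {v} u→v with rank u <? rank v | rank v <? rank u
    ... | yes u<v | _       = u<v
    ... | no _    | yes v<u = ⊥-elim (acyclic u (reach-trans u→v (rank-reach v<u)))
    ... | no u≮v  | no v≮u  =
      ⊥-elim (acyclic u (subst (Reach⁺ graph u) (rank-injective (≤-antisym (≮⇒≥ u≮v) (≮⇒≥ v≮u))) u→v))

    path-edge-into : ∀ e → ∃[ h ] (head h ≡ head e × suc (rank (tail h)) ≡ rank (head e))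
    path-edge-into e with rank (head e) in eq | reach-rank (one e)
    ... | suc k | _ with fromℕ< k<n | toℕ-fromℕ< k<n
      where
      k<n : k < n
      k<n = <-trans (n<1+n k) (subst (_< n) eq (toℕ<n (pos (head e))))
    ...   | i | to-i with p-edge i (pos (head e)) (trans eq (cong suc (sym to-i)))
    ...     | h , tl , hd = h , trans hd (p-pos (head e)) , cong suc (trans (cong rank tl) (trans (rank-p i) to-i))

    -- d is the source angle and i the sink angle of a face.
    module Face {x d i : D} (x~d : x ~ opp d) (dir-d : dir d ≡ true) (dir-i : dir i ≡ false)
                (ang-d : Angle d) (ang-i : Angle i) (d~i : opp d ~ opp i) where

      turn-opp : ∀ {x} → Angle x → Turn (opp x)
      turn-opp {x} ang = trans (cong dir (φ-opp x)) (trans ang (sym (not-involutive (dir x))))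

      dir-σd : dir (σ d) ≡ true
      dir-σd = trans ang-d dir-d

      dir-σi : dir (σ i) ≡ false
      dir-σi = trans ang-i dir-i

      -- The left side runs from `σ d` up to `opp i`, its only turn. Either more edges follow, and
      -- the first one ends before the sink, or `σ d` is the whole side.
      left-rank : rank (at (opp (σ d))) < rank (at i) ⊎
                  (at (opp (σ d)) ≡ at i × sideLen true x ≡ 1)
      left-rank with run (σ d)
      ... | z , σd~z , dir-z , turn , rel with turn-unique {z} {opp i} turn (turn-opp ang-i)
              (trans dir-z (trans dir-σd (cong not (sym dir-i))))
              (~-trans (~-sym σd~z) (~-trans (~-sym (~-opp-σ d)) d~i))
      ...   | refl with rel
      ...     | inj₂ (_ , lt) = inj₁ (subst (rank (at (opp (σ d))) <_) (cong (rank ∘ at) (opp-opp i))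
                  (reach-rank (subst (λ b → Lt b (at (opp (σ d))) (at (opp (opp i)))) dir-σd lt)))
      ...     | inj₁ eq = inj₂ (cong at (trans (cong opp eq) (opp-opp i)) ,
                  subst (λ b → sideLen b x ≡ 1) dir-σd
                    (side-single (~-trans x~d (~-opp-σ d)) (subst Turn (sym eq) turn)
                      (cong not (trans (cong dir (σ⁻¹σ d)) (sym ang-d)))))

      -- The same for the right side, which the face traverses downward from `σ i` to `opp d`.
      right-rank : rank (at (opp d)) < rank (at i) ⊎
                   (at (opp d) ≡ at i × sideLen false x ≡ 1)
      right-rank with run (σ i)
      ... | z , σi~z , dir-z , turn , rel with turn-unique {z} {opp d} turn (turn-opp ang-d)
              (trans dir-z (trans dir-σi (cong not (sym dir-d))))
              (~-trans (~-sym σi~z) (~-trans (~-sym (~-opp-σ i)) (~-sym d~i)))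
      ...   | refl with rel
      ...     | inj₂ (lt , _) = inj₁ (subst (λ v → rank (at (opp d)) < rank v) (σ-vert i)
                  (reach-rank (subst (λ b → Lt b (at (σ i)) (at (opp d))) dir-σi lt)))
      ...     | inj₁ eq = inj₂ (trans (cong at (sym eq)) (σ-vert i) ,
                  subst (λ b → sideLen b x ≡ 1) (cong not dir-d)
                    (side-single x~d turn
                      (cong not (trans (cong dir (trans (cong σ⁻¹ (sym eq)) (σ⁻¹σ i)))
                        (trans dir-i (cong not (sym dir-d)))))))

    weaken : ∀ {u v} {A : Set} → rank u < rank v ⊎ (u ≡ v × A) → rank u ≤ rank v
    weaken (inj₁ lt)         = <⇒≤ lt
    weaken (inj₂ (refl , _)) = ≤-refl

    strict : ∀ {u v k} → rank u < rank v ⊎ (u ≡ v × k ≡ 1) → 2 ≤ k → rank u < rank v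
    strict (inj₁ lt)         _          = lt
    strict (inj₂ (_ , refl)) (s≤s ())

    -- Counting below a threshold.

    -- L′ contains the edges with head of rank below c. Send such an edge e to the
    -- source angle of the face for which (e , false) is the sink angle or, if e
    -- is the last edge at its head, to an edge of L′ at the predecessor of this
    -- head which is not followed in L′ by a good angle. Extended by the identity,
    -- this is injective and misses e₀, an impossibility.
    module Descent (c : ℕ) (L′ : D → Set) (L′? : ∀ d → Dec (L′ d))
                   (L′-dir : ∀ {d} → L′ d → dir d ≡ true)
                   (low⇒L′ : ∀ {d} → dir d ≡ true → rank (at (opp d)) < c → L′ d)
                   (high-continues : ∀ {d} → L′ d → ¬ rank (at (opp d)) < c → L′ (σ d) × Good d)
                   {e₀ : Fin m} (low₀ : rank (head e₀) < c)
                   (continues₀ : L′ (σ (e₀ , true)) × Good (e₀ , true))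
                   (high-sink : ∀ {i} → dir i ≡ false → Angle i → opp i ~ (e₀ , false) → ¬ rank (at i) < c) where

      Low : Fin m → Set
      Low e = rank (head e) < c

      Stops : D → Set
      Stops d = ¬ (L′ (σ d) × Good d)

      Sent : Fin m → Fin m → Set
      Sent e e′ = (¬ Low e × e′ ≡ e)
                ⊎ (Low e × Good (e , false) × Angle (e′ , true) × (e′ , false) ~ (e , true))
                ⊎ (Low e × ¬ Good (e , false) × L′ (e′ , true) × Stops (e′ , true) ×
                   suc (rank (tail e′)) ≡ rank (head e))

      -- Rotate from `e`, which lies in `L′`. Either a member stops on the way, or membership
      -- reaches `ℓ`, which stops because it is not good.
      stop-exists : ∀ e → Low e → ∃[ e′ ] (L′ (e′ , true) × Stops (e′ , true) × tail e′ ≡ tail e)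
      stop-exists e low with last-exists true (λ eq → t-sink (e , eq))
      ... | ℓ , at-ℓ , _ , bad with σ-cycle (e , true) ℓ (sym at-ℓ)
      ...   | k , eq with iter-until σ L′ Stops step (e , true) (low⇒L′ refl low) k
        where
        step : ∀ d → L′ d → Stops d ⊎ L′ (σ d)
        step d _ with L′? (σ d) ×-dec good? d
        ... | yes (l′ , _) = inj₂ l′
        ... | no stops     = inj₁ stops
      ...     | found = result found
        where
        from-dart : ∀ d → L′ d → Stops d → at d ≡ tail e →
                    ∃[ e′ ] (L′ (e′ , true) × Stops (e′ , true) × tail e′ ≡ tail e)
        from-dart (e′ , true)  l′ stops tl = e′ , l′ , stops , tl
        from-dart (e′ , false) l′ _     _  = contradiction (L′-dir l′) λ ()
        result : (∃[ j ] (L′ (iter σ j (e , true)) × Stops (iter σ j (e , true)))) ⊎ L′ (iter σ k (e , true)) →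
                 ∃[ e′ ] (L′ (e′ , true) × Stops (e′ , true) × tail e′ ≡ tail e)
        result (inj₁ (j , l′ , stops)) = from-dart _ l′ stops (iter-σ-vert j (e , true))
        result (inj₂ l′) = from-dart ℓ (subst L′ eq l′) (λ q → bad (proj₂ q)) at-ℓ

      send : ∀ e → ∃[ e′ ] Sent e e′
      send e with rank (head e) <? c
      ... | no high = e , inj₁ (high , refl)
      ... | yes low with good? (e , false)
      ...   | yes good with turn-exists false (e , true)
      ...     | z@(e′ , _) , e~z , refl , turn = e′ , inj₂ (inj₁ (low , good , turn , ~-sym e~z))
      send e | yes low | no bad with path-edge-into e
      ... | h , hd , step with stop-exists h (subst (λ v → rank v < c) (sym hd) low)
      ...   | e′ , l′ , stops , tl = e′ , inj₂ (inj₂ (low , bad , l′ , stops , trans (cong (suc ∘ rank) tl) step))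

      module _ {e e′ : Fin m} (low : Low e) (good : Good (e , false)) (ang : Angle (e′ , true))
               (face : (e′ , false) ~ (e , true)) where

        open Face {e′ , false} {e′ , true} {e , false} ~-refl refl refl ang (proj₁ good) face

        source-low : Low e′
        source-low = ≤-<-trans (weaken right-rank) low

        -- The first edge of each side ends no later than the low sink, so the source angle links
        -- two edges of `L′`. This separates its edge from those that stop.
        source-continues : L′ (σ (e′ , true)) × Good (e′ , true)
        source-continues = low⇒L′ dir-σd (≤-<-trans (weaken left-rank) low) ,
                           ang , inner-~ (~-sym face) (proj₂ good)

      stop-low : ∀ {e} → L′ (e , true) → Stops (e , true) → Low e
      stop-low {e} l′ stops with rank (head e) <? c
      ... | yes low = low
      ... | no high = ⊥-elim (stops (high-continues l′ high))

      sent-injective : ∀ {e₁ e₂} e → Sent e₁ e → Sent e₂ e → e₁ ≡ e₂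
      sent-injective e (inj₁ (_ , refl)) (inj₁ (_ , refl)) = refl
      sent-injective e (inj₁ (high , refl)) (inj₂ (inj₁ (low , g , a , f))) = ⊥-elim (high (source-low low g a f))
      sent-injective e (inj₁ (high , refl)) (inj₂ (inj₂ (_ , _ , l , st , _))) = ⊥-elim (high (stop-low l st))
      sent-injective e (inj₂ (inj₁ (low , g , a , f))) (inj₁ (high , refl)) = ⊥-elim (high (source-low low g a f))
      sent-injective e (inj₂ (inj₂ (_ , _ , l , st , _))) (inj₁ (high , refl)) = ⊥-elim (high (stop-low l st))
      sent-injective e (inj₂ (inj₁ (_ , g , _ , f))) (inj₂ (inj₁ (_ , g′ , _ , f′))) =
        cong proj₁ (angle-unique (proj₁ g) (proj₁ g′) refl (~-trans (~-sym f) f′))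
      sent-injective e (inj₂ (inj₁ (low , g , a , f))) (inj₂ (inj₂ (_ , _ , _ , st , _))) =
        ⊥-elim (st (source-continues low g a f))
      sent-injective e (inj₂ (inj₂ (_ , _ , _ , st , _))) (inj₂ (inj₁ (low , g , a , f))) =
        ⊥-elim (st (source-continues low g a f))
      sent-injective e (inj₂ (inj₂ (_ , bad , _ , _ , eq))) (inj₂ (inj₂ (_ , bad′ , _ , _ , eq′))) =
        cong proj₁ (last-unique bad bad′ refl (rank-injective (trans (sym eq) eq′)))

      -- Three properties exclude the three ways of being hit: `e₀` is low, its face has a sink that
      -- is not low, and `e₀` does not stop.
      missed : ∀ {e} → ¬ Sent e e₀
      missed (inj₁ (high , refl)) = high low₀
      missed (inj₂ (inj₁ (low , g , _ , f))) = high-sink refl (proj₁ g) (~-sym f) low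
      missed (inj₂ (inj₂ (_ , _ , _ , st , _))) = st continues₀

      absurd : ⊥
      absurd with injective⇒surjective refl (λ e → proj₁ (send e))
        (λ {e₁} {e₂} eq → sent-injective _ (subst (Sent e₁) eq (proj₂ (send e₁))) (proj₂ (send e₂))) e₀
      ... | e , eq = missed (subst (Sent e) eq (proj₂ (send e)))

    descent : (c : ℕ) (L′ : D → Set) → (∀ d → Dec (L′ d)) → (∀ {d} → L′ d → dir d ≡ true) →
              (∀ {d} → dir d ≡ true → rank (at (opp d)) < c → L′ d) →
              (∀ {d} → L′ d → ¬ rank (at (opp d)) < c → L′ (σ d) × Good d) →
              ∀ {d₀} → dir d₀ ≡ true → rank (at (opp d₀)) < c → L′ (σ d₀) × Good d₀ →
              (∀ {i} → dir i ≡ false → Angle i → opp i ~ opp d₀ → ¬ rank (at i) < c) → ⊥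
    descent c L′ L′? L′-dir low⇒L′ high {e₀ , .true} refl = Descent.absurd c L′ L′? L′-dir low⇒L′ high

    -- Excluding both rhombi.

    -- The threshold is the rank of the sink of the rhombus. Both sides being long, both edges at
    -- its source end strictly earlier, so the source angle links two low edges while the sink is
    -- not low.
    no-weak : ¬ WeakRhombus P
    no-weak (x , int , ll , rl) with turn-exists false x | turn-exists true x
    ... | z@(e₀ , _) , x~z , refl , turn | y@(f , _) , x~y , refl , turn′ =
      descent c L (λ d → (dir d ≟ᵇ true) ×-dec (rank (at (opp d)) <? c)) proj₁ _,_
        (λ l high → ⊥-elim (high (proj₂ l))) {e₀ , true} refl (strict right-rank rl)
        ((dir-σd , strict left-rank ll) , turn , inner-~ x~z (internal⇒¬outer int))
        (λ dir-i ang-i i~d → <-irrefl (cong (rank ∘ at)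
          (angle-unique ang-i turn′ dir-i (~-trans i~d (~-trans (~-sym x~z) x~y)))))
      where
      c : ℕ
      c = rank (head f)
      L : D → Set
      L d = dir d ≡ true × rank (at (opp d)) < c
      open Face {x} {e₀ , true} {f , false} x~z refl refl turn turn′ (~-trans (~-sym x~z) x~y)

    single⇒turns : ∀ y → sideLen (dir y) y ≡ 1 → Turn y × dir (φ⁻¹ y) ≡ not (dir y)
    single⇒turns y one-edge with bool-split (dir y) (dir (φ y)) | bool-split (dir y) (dir (φ⁻¹ y))
    ... | inj₁ same | _ = ⊥-elim (1+n≰n (subst (2 ≤_) one-edge (side-long ~-refl same)))
    ... | inj₂ _ | inj₁ same = ⊥-elim (1+n≰n (subst (2 ≤_) one-edge (subst (λ b → 2 ≤ sideLen b y) same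
            (side-long (~-sym (~-step (φφ⁻¹ y))) (trans (cong dir (φφ⁻¹ y)) (sym same))))))
    ... | inj₂ turn | inj₂ before = turn , before

    -- The threshold is the rank of the common sink. The diagonal `o` is not low, but as an
    -- additional member of `L` it links the low first edges `d₀` and `σ o` of the two long sides.
    -- So `d₀` continues although the sink of the right face is not low.
    no-strong : ¬ StrongRhombus P
    no-strong (e , (intˡ , single-e , ll) , (intʳ , single-e′ , rl))
      with single⇒turns (e , false) single-e | single⇒turns (e , true) single-e′
    ... | turnˡ , beforeˡ | turnʳ , beforeʳ =
      descent c L (λ d → (dir d ≟ᵇ true) ×-dec ((rank (at (opp d)) <? c) ⊎-dec _≟d_ graph d o))
        proj₁ (λ dd lt → dd , inj₁ lt) high-continues
        dir-d₀ (strict Right.right-rank rl)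
        (subst L (sym (σσ⁻¹ o)) (refl , inj₂ refl) , ang-d₀ , inner-~ d₀~o (internal⇒¬outer intʳ))
        (λ dir-i′ ang-i′ i′~d₀ → <-irrefl (cong (rank ∘ at)
          (angle-unique ang-i′ turnʳ dir-i′ (~-trans i′~d₀ (~-sym d₀~o)))))
      where
      o i d₀ i₁ : D
      o  = e , true
      i  = e , false
      d₀ = σ⁻¹ o
      i₁ = σ⁻¹ i
      c : ℕ
      c = rank (head e)
      L : D → Set
      L d = dir d ≡ true × (rank (at (opp d)) < c ⊎ d ≡ o)
      dir-d₀ : dir d₀ ≡ true
      dir-d₀ = not-injective beforeʳ
      dir-i₁ : dir i₁ ≡ false
      dir-i₁ = not-injective beforeˡ
      ang-d₀ : Angle d₀
      ang-d₀ = trans (cong dir (σσ⁻¹ o)) (sym dir-d₀)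
      ang-i₁ : Angle i₁
      ang-i₁ = trans (cong dir (σσ⁻¹ i)) (sym dir-i₁)
      d₀~o : o ~ opp d₀
      d₀~o = ~-sym (~-step (φφ⁻¹ o))
      module Left = Face {i} {o} {i₁} ~-refl refl dir-i₁ turnˡ ang-i₁ (~-sym (~-step (φφ⁻¹ i)))
      module Right = Face {o} {d₀} {i} d₀~o dir-d₀ refl ang-d₀ turnʳ (~-sym d₀~o)
      high-continues : ∀ {d} → L d → ¬ rank (at (opp d)) < c → L (σ d) × Good d
      high-continues (_ , inj₁ low) high = ⊥-elim (high low)
      -- Only `o` can be high; its successor begins the long side of the left face and is therefore
      -- low.
      high-continues (_ , inj₂ refl) _ =
        (turnˡ , inj₁ (subst (λ v → rank (at (opp (σ o))) < rank v) (σ⁻¹-vert i) (strict Left.left-rank ll))) ,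
        turnˡ , internal⇒¬outer intˡ

theorem1 : (G : PlanarSTDigraph) →
    HamiltonianPath (PlanarSTDigraph.graph G) ⇔ (¬ StrongRhombus G × ¬ WeakRhombus G)
theorem1 G = mk⇔
  (λ (p , p-injective , p-edge) → Path.no-strong p p-injective p-edge , Path.no-weak p p-injective p-edge)
  (λ (¬strong , ¬weak) → NoRhombus.hamiltonian ¬strong ¬weak)
  where open Embedding G
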